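{- Let $D=(V,A)$ be a finite simple digraph with $n=|V|\ge 1$. (i) $F(D)=n-1$ if and only if $D$ has a source. (ii) $F(D)=n-2$ if and only if there exist distinct $u,v\in V$ with $N_D^-(u)\setminus\{v\}=N_D^-(v)\setminus\{u\}$, and $\deg^-(w)>0$ for all $w\in V$. (iii) $F(D)=n-3$ if and only if all of the following conditions are satisfied: 1. $\deg^-(v)>0$ for all $v\in V$; 2. for any distinct vertices $u,v\in V$, $N_D^-(u)\setminus\{v\}\neq N_D^-(v)\setminus\{u\}$; 3. there exist distinct vertices $u,v,w\in V$ such that $N_D^-(u)\setminus\{v,w\}\subseteq N_D^-(v)\cup N_D^-(w)$, $N_D^-(v)\setminus\{u,w\}\subseteq N_D^-(u)\cup N_D^-(w)$, and $N_D^-(w)\setminus\{u,v\}\subseteq N_D^-(u)\cup N_D^-(v)$.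
   Context: A finite simple digraph $D=(V,A)$ has finite nonempty vertex set $V$ and arc set $A$ consisting of ordered pairs of distinct vertices (no loops, no parallel arcs; both $(u,v)$ and $(v,u)$ may be present). $N_D^+(v)=\{u:(v,u)\in A\}$ is the set of out-neighbors of $v$, $N_D^-(v)=\{u:(u,v)\in A\}$ the set of in-neighbors, and $\deg^{\pm}(v)=|N_D^{\pm}(v)|$. A source is a vertex $v$ with $\deg^-(v)=0$. Zero forcing: for $S\subseteq V$ let $B^0(S)=S$ and $B^{i+1}(S)=B^i(S)\cup\{w:\{w\}=N_D^+(v)\setminus B^i(S)\text{ for some }v\in B^i(S)\}$. $S$ is a zero forcing set (ZFS) if $B^t(S)=V$ for some $t\ge 0$, and a failed zero forcing set (FZFS) otherwise. The failed zero forcing number $F(D)$ is the largest cardinality of an FZFS of $D$. -}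

module Defs where

import Data.Bool.Properties as Bool
open import Data.Empty using (⊥-elim)
open import Data.Fin.Base using (Fin)
open import Data.Fin.Properties using (any?)
open import Data.Fin.Subset
open import Data.Fin.Subset.Properties
open import Data.Nat.Base using (ℕ; zero; suc; _+_; _≤_; _<_; NonZero; ≢-nonZero⁻¹)
import Data.Nat.Properties as ℕ
open import Data.Product.Base using (∃; _×_; _,_; proj₁; proj₂)
open import Data.Sum.Base using (inj₁; inj₂)
open import Data.Vec.Base using (tabulate)
open import Data.Vec.Properties using (≡-dec; lookup∘tabulate; []=⇒lookup; lookup⇒[]=)
open import Function.Base using (_∘_)
open import Level using (0ℓ)
open import Relation.Binary.Core using (Rel)
import Relation.Binary.Definitions as B
open import Relation.Binary.PropositionalEquality
open import Relation.Nullary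
open import Relation.Nullary.Decidable using (dec-true; decidable-stable)
open import Relation.Unary using (Pred; Decidable)

private
  variable
    n : ℕ

-- Finite simple digraphs with vertex set Fin n.  Arcs are decidable so that
-- neighbourhoods exist as elements of Subset n.
record Digraph (n : ℕ) : Set₁ where
  field
    _⟶_      : Rel (Fin n) 0ℓ
    _⟶?_     : B.Decidable _⟶_
    loopless : ∀ {v} → ¬ (v ⟶ v)

⟦_⟧ : {P : Pred (Fin n) 0ℓ} → Decidable P → Subset n
⟦ P? ⟧ = tabulate (does ∘ P?)

∈⟦⟧⁺ : {P : Pred (Fin n) 0ℓ} (P? : Decidable P) {x : Fin n} → P x → x ∈ ⟦ P? ⟧
∈⟦⟧⁺ P? {x} px =
  lookup⇒[]= x _ (trans (lookup∘tabulate (does ∘ P?) x) (dec-true (P? x) px))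

∈⟦⟧⁻ : {P : Pred (Fin n) 0ℓ} (P? : Decidable P) {x : Fin n} → x ∈ ⟦ P? ⟧ → P x
∈⟦⟧⁻ P? {x} x∈ with P? x | trans (sym (lookup∘tabulate (does ∘ P?) x)) ([]=⇒lookup x∈)
... | yes px | _ = px

module _ (D : Digraph n) where
  open Digraph D

  N⁺ : Fin n → Subset n
  N⁺ v = ⟦ (λ u → v ⟶? u) ⟧

  N⁻ : Fin n → Subset n
  N⁻ v = ⟦ (λ u → u ⟶? v) ⟧

  deg⁺ : Fin n → ℕ
  deg⁺ v = ∣ N⁺ v ∣

  deg⁻ : Fin n → ℕ
  deg⁻ v = ∣ N⁻ v ∣

  IsSource : Fin n → Set
  IsSource v = deg⁻ v ≡ 0

  Forced : Subset n → Fin n → Set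
  Forced S w = ∃ λ v → v ∈ S × ⁅ w ⁆ ≡ N⁺ v ─ S

  forced? : ∀ S → Decidable (Forced S)
  forced? S w = any? λ v → (v ∈? S) ×-dec ≡-dec Bool._≟_ ⁅ w ⁆ (N⁺ v ─ S)

  step : Subset n → Subset n
  step S = S ∪ ⟦ forced? S ⟧

  B : ℕ → Subset n → Subset n
  B zero    S = S
  B (suc i) S = step (B i S)

  IsZFS : Subset n → Set
  IsZFS S = ∃ λ t → B t S ≡ ⊤

  IsFZFS : Subset n → Set
  IsFZFS S = ¬ IsZFS S

  IsMaxFZFSSize : ℕ → Set
  IsMaxFZFSSize k = (∃ λ S → IsFZFS S × ∣ S ∣ ≡ k) × (∀ S → IsFZFS S → ∣ S ∣ ≤ k)

  private
    B-step : ∀ t S → B t (step S) ≡ B (suc t) S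
    B-step zero    S = refl
    B-step (suc t) S = cong step (B-step t S)

    B-fixed : ∀ {S} → step S ≡ S → ∀ t → B t S ≡ S
    B-fixed eq zero    = refl
    B-fixed eq (suc t) = trans (cong step (B-fixed eq t)) eq

    S⊆step : ∀ S → S ⊆ step S
    S⊆step S = p⊆p∪q ⟦ forced? S ⟧

    step-grows : ∀ S → step S ≢ S → ∣ S ∣ < ∣ step S ∣
    step-grows S ≢S with step S ⊆? S
    ... | yes ⊆S = ⊥-elim (≢S (⊆-antisym ⊆S (S⊆step S)))
    ... | no  ⊈S with any? (λ x → (x ∈? step S) ×-dec ¬? (x ∈? S))
    ...   | yes new = p⊂q⇒∣p∣<∣q∣ (S⊆step S , new)
    ...   | no none = ⊥-elim (⊈S λ {x} x∈ → decidable-stable (x ∈? S) λ x∉ → none (x , x∈ , x∉))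

    -- k bounds the number of vertices outside S.
    zfs?′ : ∀ k S → n ≤ k + ∣ S ∣ → Dec (IsZFS S)
    zfs?′ zero S n≤ = yes (0 , ∣p∣≡n⇒p≡⊤ (ℕ.≤-antisym (∣p∣≤n S) n≤))
    zfs?′ (suc k) S n≤ with ≡-dec Bool._≟_ (step S) S
    ... | yes fixed with ≡-dec Bool._≟_ S ⊤
    ...   | yes S≡⊤ = yes (0 , S≡⊤)
    ...   | no  S≢⊤ = no λ (t , eq) → S≢⊤ (trans (sym (B-fixed fixed t)) eq)
    zfs?′ (suc k) S n≤ | no moved
      with zfs?′ k (step S)
             (ℕ.≤-trans n≤ (ℕ.≤-trans (ℕ.≤-reflexive (sym (ℕ.+-suc k ∣ S ∣)))
                                      (ℕ.+-monoʳ-≤ k (step-grows S moved))))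
    ... | yes (t , eq) = yes (suc t , trans (sym (B-step t S)) eq)
    ... | no ¬zfs = no λ where
      (zero  , eq) → moved (⊆-antisym (λ {x} _ → subst (x ∈_) (sym eq) ∈⊤) (S⊆step S))
      (suc t , eq) → ¬zfs (t , trans (B-step t S) eq)

  isZFS? : Decidable IsZFS
  isZFS? S = zfs?′ n S (ℕ.m≤m+n n ∣ S ∣)

  private
    step-⊥ : step ⊥ ≡ ⊥
    step-⊥ = Empty-unique λ (x , x∈) → case x∈
      where
      case : ∀ {x} → ¬ (x ∈ step ⊥)
      case x∈ with x∈p∪q⁻ ⊥ ⟦ forced? ⊥ ⟧ x∈
      ... | inj₁ x∈⊥ = ∉⊥ x∈⊥
      ... | inj₂ x∈F = ∉⊥ (proj₁ (proj₂ (∈⟦⟧⁻ (forced? ⊥) x∈F)))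

  ⊥-isFZFS : .{{NonZero n}} → IsFZFS ⊥
  ⊥-isFZFS (t , eq) = ≢-nonZero⁻¹ n (begin
    n             ≡⟨ ∣⊤∣≡n n ⟨
    ∣ ⊤ {n} ∣     ≡⟨ cong ∣_∣ eq ⟨
    ∣ B t ⊥ ∣     ≡⟨ cong ∣_∣ (B-fixed step-⊥ t) ⟩
    ∣ ⊥ {n} ∣     ≡⟨ ∣⊥∣≡0 n ⟩
    0             ∎)
    where open ≡-Reasoning

  private
    search : .{{NonZero n}} → ∀ k → (∀ S → IsFZFS S → ∣ S ∣ ≤ k) → ∃ IsMaxFZFSSize
    search zero    bd = 0 , (⊥ , ⊥-isFZFS , ∣⊥∣≡0 n) , bd
    search (suc k) bd with anySubset? (λ S → ¬? (isZFS? S) ×-dec (∣ S ∣ ℕ.≟ suc k))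
    ... | yes found = suc k , found , bd
    ... | no  none  = search k λ S fz →
      ℕ.m<1+n⇒m≤n (ℕ.≤∧≢⇒< (bd S fz) λ eq → none (S , fz , eq))

  maxFZFSSize : .{{NonZero n}} → ∃ IsMaxFZFSSize
  maxFZFSSize = search n λ S _ → ∣p∣≤n S

  -- The failed zero forcing number.
  F : .{{NonZero n}} → ℕ
  F = proj₁ maxFZFSSize

  F-isMax : .{{_ : NonZero n}} → IsMaxFZFSSize F
  F-isMax = proj₂ maxFZFSSize

{-# OPTIONS --safe #-}

-- The complement of a failed set that forces nothing further is a fort: a
-- nonempty W such that no vertex outside W has exactly one out-neighbour in W.
-- Complements of forts are failed, and a maximum failed set forces nothing,
-- so F D + k ≡ n exactly when k is the least size of a fort.  The three
-- conditions describe the forts of size 1, 2 and 3.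

module Submission where

open import Defs
open import Data.Empty using (⊥-elim)
open import Data.Fin.Base using (Fin; zero; suc)
open import Data.Fin.Properties using (any?; _≟_)
open import Data.Fin.Subset
  using (Subset; inside; outside; ∣_∣; ∁; Empty; Nonempty; _∈_; _∉_; _⊆_; _∪_; _─_; _-_; ⁅_⁆)
open import Data.Fin.Subset.Properties
open import Data.Nat.Base using (ℕ; suc; _+_; _≤_; _<_; _>_; z<s; s<s; NonZero)
import Data.Nat.Properties as ℕ
open import Data.Product.Base using (∃; ∃₂; _×_; _,_; proj₁; proj₂)
open import Data.Sum.Base as Sum using (_⊎_; inj₁; inj₂; [_,_]′)
open import Data.Vec.Base using (_∷_; here; there)
open import Function.Base using (_∘_)
open import Function.Bundles using (_⇔_; mk⇔; Equivalence)
open import Relation.Binary.PropositionalEquality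
  using (_≡_; _≢_; refl; sym; trans; cong; subst; ≢-sym)
open import Relation.Nullary using (¬_; yes; no; contradiction; ¬?; _×-dec_)
open import Relation.Nullary.Decidable using (decidable-stable)

private
  variable
    n k : ℕ

-- Finite subsets: cardinality, and explicit sets of at most three elements.

x∈p─q⇒x∉q : ∀ (p q : Subset n) {x} → x ∈ p ─ q → x ∉ q
x∈p─q⇒x∉q (_ ∷ p) (inside  ∷ q) (there x∈) (there x∈q) = x∈p─q⇒x∉q p q x∈ x∈q
x∈p─q⇒x∉q (_ ∷ p) (outside ∷ q) (there x∈) (there x∈q) = x∈p─q⇒x∉q p q x∈ x∈q

x∉p∪q⁺ : ∀ {p q : Subset n} {x} → x ∉ p → x ∉ q → x ∉ p ∪ q
x∉p∪q⁺ {p = p} {q} x∉p x∉q = [ x∉p , x∉q ]′ ∘ x∈p∪q⁻ p q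

∣p∣≡0⇒Empty : ∀ {p : Subset n} → ∣ p ∣ ≡ 0 → Empty p
∣p∣≡0⇒Empty {p = p} eq (x , x∈p) = ℕ.n≮0 (subst (∣ p - x ∣ <_) eq (x∈p⇒∣p-x∣<∣p∣ x∈p))

Empty⇒∣p∣≡0 : ∀ {p : Subset n} → Empty p → ∣ p ∣ ≡ 0
Empty⇒∣p∣≡0 {n} e = trans (cong ∣_∣ (Empty-unique e)) (∣⊥∣≡0 n)

∣p∣+∣∁p∣≡n : ∀ (p : Subset n) → ∣ p ∣ + ∣ ∁ p ∣ ≡ n
∣p∣+∣∁p∣≡n p = trans (cong (∣ p ∣ +_) (∣∁p∣≡n∸∣p∣ p)) (ℕ.m+[n∸m]≡n (∣p∣≤n p))

∣⁅x⁆∪p∣≡1+∣p∣ : ∀ (x : Fin n) (p : Subset n) → x ∉ p → ∣ ⁅ x ⁆ ∪ p ∣ ≡ suc ∣ p ∣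
∣⁅x⁆∪p∣≡1+∣p∣ zero    (inside  ∷ p) x∉ = ⊥-elim (x∉ here)
∣⁅x⁆∪p∣≡1+∣p∣ zero    (outside ∷ p) x∉ = cong (suc ∘ ∣_∣) (∪-identityˡ p)
∣⁅x⁆∪p∣≡1+∣p∣ (suc x) (inside  ∷ p) x∉ = cong suc (∣⁅x⁆∪p∣≡1+∣p∣ x p (x∉ ∘ there))
∣⁅x⁆∪p∣≡1+∣p∣ (suc x) (outside ∷ p) x∉ = ∣⁅x⁆∪p∣≡1+∣p∣ x p (x∉ ∘ there)

-- The smallest element of `p` is split off. Keeping `x ∉ q` is what makes the elements pairwise
-- distinct when the splitting is iterated for sizes 2 and 3.
∣p∣≡1+k⇒p≡⁅x⁆∪q : ∀ (p : Subset n) → ∣ p ∣ ≡ suc k →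
                  ∃₂ λ x q → x ∉ q × ∣ q ∣ ≡ k × p ≡ ⁅ x ⁆ ∪ q
∣p∣≡1+k⇒p≡⁅x⁆∪q (inside  ∷ p) eq =
  zero , outside ∷ p , (λ ()) , ℕ.suc-injective eq , cong (inside ∷_) (sym (∪-identityˡ p))
∣p∣≡1+k⇒p≡⁅x⁆∪q (outside ∷ p) eq with ∣p∣≡1+k⇒p≡⁅x⁆∪q p eq
... | x , q , x∉q , ∣q∣≡k , p≡ =
  suc x , outside ∷ q , (λ { (there x∈q) → x∉q x∈q }) , ∣q∣≡k , cong (outside ∷_) p≡

∣p∣≡1⇒p≡⁅x⁆ : ∀ (p : Subset n) → ∣ p ∣ ≡ 1 → ∃ λ x → p ≡ ⁅ x ⁆
∣p∣≡1⇒p≡⁅x⁆ p eq with ∣p∣≡1+k⇒p≡⁅x⁆∪q p eq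
... | x , q , _ , ∣q∣≡0 , p≡ =
  x , trans p≡ (trans (cong (⁅ x ⁆ ∪_) (Empty-unique (∣p∣≡0⇒Empty ∣q∣≡0))) (∪-identityʳ ⁅ x ⁆))

∣p∣≡2⇒p≡⁅u⁆∪⁅v⁆ : ∀ (p : Subset n) → ∣ p ∣ ≡ 2 → ∃₂ λ u v → u ≢ v × p ≡ ⁅ u ⁆ ∪ ⁅ v ⁆
∣p∣≡2⇒p≡⁅u⁆∪⁅v⁆ p eq with ∣p∣≡1+k⇒p≡⁅x⁆∪q p eq
... | u , q , u∉q , ∣q∣≡1 , p≡ with ∣p∣≡1⇒p≡⁅x⁆ q ∣q∣≡1
...   | v , refl = u , v , x∉⁅y⁆⇒x≢y u∉q , p≡

∣p∣≡3⇒p≡⁅u⁆∪⁅v⁆∪⁅w⁆ : ∀ (p : Subset n) → ∣ p ∣ ≡ 3 → ∃ λ u → ∃ λ v → ∃ λ w →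
  u ≢ v × u ≢ w × v ≢ w × p ≡ ⁅ u ⁆ ∪ (⁅ v ⁆ ∪ ⁅ w ⁆)
∣p∣≡3⇒p≡⁅u⁆∪⁅v⁆∪⁅w⁆ p eq with ∣p∣≡1+k⇒p≡⁅x⁆∪q p eq
... | u , q , u∉q , ∣q∣≡2 , p≡ with ∣p∣≡2⇒p≡⁅u⁆∪⁅v⁆ q ∣q∣≡2
...   | v , w , v≢w , refl =
  u , v , w , x∉⁅y⁆⇒x≢y (u∉q ∘ p⊆p∪q _) , x∉⁅y⁆⇒x≢y (u∉q ∘ q⊆p∪q _ _) , v≢w , p≡

∣⁅u⁆∪⁅v⁆∣≡2 : ∀ {u v : Fin n} → u ≢ v → ∣ ⁅ u ⁆ ∪ ⁅ v ⁆ ∣ ≡ 2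
∣⁅u⁆∪⁅v⁆∣≡2 {u = u} {v} u≢v =
  trans (∣⁅x⁆∪p∣≡1+∣p∣ u ⁅ v ⁆ (x≢y⇒x∉⁅y⁆ u≢v)) (cong suc (∣⁅x⁆∣≡1 v))

∣⁅u⁆∪⁅v⁆∪⁅w⁆∣≡3 : ∀ {u v w : Fin n} → u ≢ v → u ≢ w → v ≢ w → ∣ ⁅ u ⁆ ∪ (⁅ v ⁆ ∪ ⁅ w ⁆) ∣ ≡ 3
∣⁅u⁆∪⁅v⁆∪⁅w⁆∣≡3 {u = u} u≢v u≢w v≢w =
  trans (∣⁅x⁆∪p∣≡1+∣p∣ u _ (x∉p∪q⁺ (x≢y⇒x∉⁅y⁆ u≢v) (x≢y⇒x∉⁅y⁆ u≢w))) (cong suc (∣⁅u⁆∪⁅v⁆∣≡2 v≢w))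

∉⁅u⁆∪⁅v⁆ : ∀ {u v x : Fin n} → x ≢ u → x ≢ v → x ∉ ⁅ u ⁆ ∪ ⁅ v ⁆
∉⁅u⁆∪⁅v⁆ x≢u x≢v = x∉p∪q⁺ (x≢y⇒x∉⁅y⁆ x≢u) (x≢y⇒x∉⁅y⁆ x≢v)

∈⁅u⁆∪⁅v⁆⁻ : ∀ {u v x : Fin n} → x ∈ ⁅ u ⁆ ∪ ⁅ v ⁆ → x ≡ u ⊎ x ≡ v
∈⁅u⁆∪⁅v⁆⁻ {u = u} {v} = Sum.map (x∈⁅y⁆⇒x≡y u) (x∈⁅y⁆⇒x≡y v) ∘ x∈p∪q⁻ ⁅ u ⁆ ⁅ v ⁆

∈⁅u⁆∪⁅v⁆∪⁅w⁆⁻ : ∀ {u v w x : Fin n} → x ∈ ⁅ u ⁆ ∪ (⁅ v ⁆ ∪ ⁅ w ⁆) → x ≡ u ⊎ x ≡ v ⊎ x ≡ w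
∈⁅u⁆∪⁅v⁆∪⁅w⁆⁻ {u = u} {v} {w} = Sum.map (x∈⁅y⁆⇒x≡y u) ∈⁅u⁆∪⁅v⁆⁻ ∘ x∈p∪q⁻ ⁅ u ⁆ (⁅ v ⁆ ∪ ⁅ w ⁆)

-- Forts and failed zero forcing sets.

module _ (D : Digraph n) where
  open Digraph D

  ∈N⁺⁺ : ∀ {v w} → v ⟶ w → w ∈ N⁺ D v
  ∈N⁺⁺ {v} = ∈⟦⟧⁺ (v ⟶?_)

  ∈N⁺⁻ : ∀ {v w} → w ∈ N⁺ D v → v ⟶ w
  ∈N⁺⁻ {v} = ∈⟦⟧⁻ (v ⟶?_)

  ∈N⁻⁺ : ∀ {v w} → v ⟶ w → v ∈ N⁻ D w
  ∈N⁻⁺ {w = w} = ∈⟦⟧⁺ (_⟶? w)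

  ∈N⁻⁻ : ∀ {v w} → v ∈ N⁻ D w → v ⟶ w
  ∈N⁻⁻ {w = w} = ∈⟦⟧⁻ (_⟶? w)

  ⟶⇒≢ : ∀ {v w} → v ⟶ w → v ≢ w
  ⟶⇒≢ v⟶v refl = loopless v⟶v

  -- The condition is put positively, as a second out-neighbour supplied for each given one, so that
  -- the witness can be used directly, without counting.
  NoUniqueOutNeighbour : Subset n → Set
  NoUniqueOutNeighbour W = ∀ {v w} → v ∉ W → w ∈ W → v ⟶ w →
    ∃ λ w′ → w′ ∈ W × w′ ≢ w × v ⟶ w′

  Fort : Subset n → Set
  Fort W = Nonempty W × NoUniqueOutNeighbour W

  HasFort : ℕ → Set
  HasFort k = ∃ λ W → Fort W × ∣ W ∣ ≡ k

  -- Induction on `t`. If `v` forced `x` in the next round, then `v` would lie outside `W` by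
  -- induction, so it would have a second out-neighbour `w′` in `W`. By induction `w′` is not yet in
  -- the set either, so `x` is not the only missing out-neighbour of `v`.
  fort-avoided : ∀ {W} → Fort W → ∀ t {x} → x ∈ W → x ∉ B D t (∁ W)
  fort-avoided fort ℕ.zero x∈W x∈∁W = x∈∁p⇒x∉p x∈∁W x∈W
  fort-avoided {W} fort (suc t) {x} x∈W x∈B
    with x∈p∪q⁻ (B D t (∁ W)) ⟦ forced? D (B D t (∁ W)) ⟧ x∈B
  ... | inj₁ x∈Bt = fort-avoided fort t x∈W x∈Bt
  ... | inj₂ x∈F with ∈⟦⟧⁻ (forced? D (B D t (∁ W))) x∈F
  ...   | v , v∈Bt , eq
    with proj₂ fort (λ v∈W → fort-avoided fort t v∈W v∈Bt) x∈W
           (∈N⁺⁻ (p─q⊆p _ (B D t (∁ W)) (subst (x ∈_) eq (x∈⁅x⁆ x))))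
  ...   | w′ , w′∈W , w′≢x , v⟶w′ =
    w′≢x (x∈⁅y⁆⇒x≡y x (subst (w′ ∈_) (sym eq)
      (x∈p∧x∉q⇒x∈p─q (∈N⁺⁺ v⟶w′) (fort-avoided fort t w′∈W))))

  fort⇒∁-FZFS : ∀ {W} → Fort W → IsFZFS D (∁ W)
  fort⇒∁-FZFS fort@((x , x∈W) , _) (t , eq) =
    fort-avoided fort t x∈W (subst (x ∈_) (sym eq) ∈⊤)

  -- Failure yields nonemptiness, and stalling yields the condition on arcs. Both are decidable
  -- existence statements, so each may be proved by refuting its negation.
  stalled-FZFS⇒∁-fort : ∀ {S} → IsFZFS D S → step D S ⊆ S → Fort (∁ S)
  stalled-FZFS⇒∁-fort {S} fz stalled = nonempty , noUnique
    where
    nonempty : Nonempty (∁ S)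
    -- An empty complement would make `S` the whole vertex set, which is zero forcing at time 0.
    nonempty = decidable-stable (nonempty? (∁ S)) λ empty →
      fz (0 , ⊆-antisym (⊆-max S) λ {x} _ → x∉∁p⇒x∈p λ x∈∁S → empty (x , x∈∁S))

    noUnique : NoUniqueOutNeighbour (∁ S)
    noUnique {v} {w} v∉∁S w∈∁S v⟶w =
      -- Without another `w′`, the vertex `v` has `w` as its only out-neighbour outside `S` and
      -- forces it; stalling then puts `w` in `S`.
      decidable-stable (any? λ w′ → (w′ ∈? ∁ S) ×-dec ¬? (w′ ≟ w) ×-dec (v ⟶? w′)) λ none →
        x∈∁p⇒x∉p w∈∁S (stalled (q⊆p∪q S _ (∈⟦⟧⁺ (forced? D S)
          (v , x∉∁p⇒x∈p v∉∁S , ⊆-antisym ⁅w⁆⊆ (⊆⁅w⁆ none)))))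
      where
      ⁅w⁆⊆ : ⁅ w ⁆ ⊆ N⁺ D v ─ S
      ⁅w⁆⊆ x∈ rewrite x∈⁅y⁆⇒x≡y w x∈ = x∈p∧x∉q⇒x∈p─q (∈N⁺⁺ v⟶w) (x∈∁p⇒x∉p w∈∁S)

      ⊆⁅w⁆ : ¬ (∃ λ w′ → w′ ∈ ∁ S × w′ ≢ w × v ⟶ w′) → N⁺ D v ─ S ⊆ ⁅ w ⁆
      ⊆⁅w⁆ none {x} x∈ with x ≟ w
      ... | yes refl = x∈⁅x⁆ w
      ... | no  x≢w  = ⊥-elim (none
        (x , x∉p⇒x∈∁p (x∈p─q⇒x∉q (N⁺ D v) S x∈) , x≢w , ∈N⁺⁻ (p─q⊆p (N⁺ D v) S x∈)))

  -- The failed zero forcing number and the least size of a fort.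

  B-step : ∀ t S → B D t (step D S) ≡ B D (suc t) S
  B-step ℕ.zero  S = refl
  B-step (suc t) S = cong (step D) (B-step t S)

  -- Starting from `step D S` only means being one round ahead, so success from there within `t`
  -- rounds is success from `S` within `suc t`.
  step-FZFS : ∀ {S} → IsFZFS D S → IsFZFS D (step D S)
  step-FZFS fz (t , eq) = fz (suc t , trans (sym (B-step t _)) eq)

  -- A newly forced vertex would make `step D S` a strictly larger failed set.
  maximum-FZFS⇒stalled : ∀ {S} → IsFZFS D S → (∀ T → IsFZFS D T → ∣ T ∣ ≤ ∣ S ∣) → step D S ⊆ S
  maximum-FZFS⇒stalled {S} fz max {x} x∈ = decidable-stable (x ∈? S) λ x∉S →
    ℕ.<⇒≱ (p⊂q⇒∣p∣<∣q∣ (p⊆p∪q _ , x , x∈ , x∉S)) (max (step D S) (step-FZFS fz))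

  F+minFort≡n : .{{_ : NonZero n}} → ∃ λ m → F D + m ≡ n × HasFort m × (∀ {j} → HasFort j → m ≤ j)
  F+minFort≡n with F-isMax D
  ... | (S , fz , ∣S∣≡F) , max = ∣ ∁ S ∣ , F+m≡n , (∁ S , fort , refl) , minimal
    where
    fort : Fort (∁ S)
    fort = stalled-FZFS⇒∁-fort fz
      (maximum-FZFS⇒stalled fz λ T fzT → ℕ.≤-trans (max T fzT) (ℕ.≤-reflexive (sym ∣S∣≡F)))

    F+m≡n : F D + ∣ ∁ S ∣ ≡ n
    F+m≡n = trans (cong (_+ ∣ ∁ S ∣) (sym ∣S∣≡F)) (∣p∣+∣∁p∣≡n S)

    minimal : ∀ {j} → HasFort j → ∣ ∁ S ∣ ≤ j
    -- The complement of `W` is failed, hence has at most `F D` elements; comparing the two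
    -- splittings of `n` and cancelling `F D` bounds the size of `∁ S` by that of `W`.
    minimal (W , fortW , refl) = ℕ.+-cancelˡ-≤ (F D) _ _ (begin
      F D + ∣ ∁ S ∣     ≡⟨ F+m≡n ⟩
      n                 ≡⟨ ∣p∣+∣∁p∣≡n W ⟨
      ∣ W ∣ + ∣ ∁ W ∣   ≡⟨ ℕ.+-comm ∣ W ∣ _ ⟩
      ∣ ∁ W ∣ + ∣ W ∣   ≤⟨ ℕ.+-monoˡ-≤ ∣ W ∣ (max (∁ W) (fort⇒∁-FZFS fortW)) ⟩
      F D + ∣ W ∣       ∎)
      where open ℕ.≤-Reasoning

  -- Addition replaces `n ∸ k`, whose truncation would give a true equation for `n` = 1 and `k` = 2,
  -- where `F D` is 0.
  F+k≡n⇔minFort : .{{_ : NonZero n}} → F D + k ≡ n ⇔ (HasFort k × (∀ {j} → j < k → ¬ HasFort j))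
  F+k≡n⇔minFort {k = k} with F+minFort≡n
  ... | m , F+m≡n , hasFort , minimal = mk⇔ to from
    where
    to : F D + k ≡ n → HasFort k × (∀ {j} → j < k → ¬ HasFort j)
    to F+k≡n with refl ← ℕ.+-cancelˡ-≡ (F D) k m (trans F+k≡n (sym F+m≡n)) =
      hasFort , λ j<k → ℕ.<⇒≱ j<k ∘ minimal

    from : HasFort k × (∀ {j} → j < k → ¬ HasFort j) → F D + k ≡ n
    from (hasFort-k , none) = trans
      (cong (F D +_) (ℕ.≤-antisym (ℕ.≮⇒≥ λ m<k → none m<k hasFort) (minimal hasFort-k))) F+m≡n

  -- Forts of sizes 0 to 3.

  ¬HasFort0 : ¬ HasFort 0
  ¬HasFort0 (W , (nonempty , _) , ∣W∣≡0) = ∣p∣≡0⇒Empty ∣W∣≡0 nonempty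

  -- A singleton has no room for a second out-neighbour, so no vertex outside it may point at its
  -- element; an in-neighbour is always outside, since there are no loops.
  HasFort1⇔ : HasFort 1 ⇔ ∃ (IsSource D)
  HasFort1⇔ = mk⇔ to from
    where
    to : HasFort 1 → ∃ (IsSource D)
    to (W , (_ , noUnique) , ∣W∣≡1) with ∣p∣≡1⇒p≡⁅x⁆ W ∣W∣≡1
    ... | w , refl = w , Empty⇒∣p∣≡0 isolated
      where
      isolated : Empty (N⁻ D w)
      isolated (v , v∈) with noUnique (x≢y⇒x∉⁅y⁆ (⟶⇒≢ (∈N⁻⁻ v∈))) (x∈⁅x⁆ w) (∈N⁻⁻ v∈)
      ... | w′ , w′∈ , w′≢w , _ = w′≢w (x∈⁅y⁆⇒x≡y w w′∈)

    from : ∃ (IsSource D) → HasFort 1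
    from (w , source) = ⁅ w ⁆ , ((w , x∈⁅x⁆ w) , noUnique) , ∣⁅x⁆∣≡1 w
      where
      noUnique : NoUniqueOutNeighbour ⁅ w ⁆
      noUnique {v} {x} _ x∈ v⟶x with refl ← x∈⁅y⁆⇒x≡y w x∈ =
        ⊥-elim (∣p∣≡0⇒Empty source (v , ∈N⁻⁺ v⟶x))

  HasTwins : Set
  HasTwins = ∃₂ λ u v → u ≢ v × N⁻ D u - v ≡ N⁻ D v - u

  -- A vertex outside the pair must point at both elements or at neither, so the two
  -- in-neighbourhoods agree outside the pair. Arcs within the pair are unconstrained, hence the
  -- deletions.
  HasFort2⇔ : HasFort 2 ⇔ HasTwins
  HasFort2⇔ = mk⇔ to from
    where
    -- `W` is known only through its members, so that the reverse inclusion follows by exchanging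
    -- `u` and `v` without rewriting the union.
    shared : ∀ {W u v} → NoUniqueOutNeighbour W → u ∈ W →
             (∀ {x} → x ∈ W → x ≡ u ⊎ x ≡ v) → N⁻ D u - v ⊆ N⁻ D v - u
    shared {u = u} {v} noUnique u∈W cases {x} x∈ with ∈N⁻⁻ (p─q⊆p (N⁻ D u) ⁅ v ⁆ x∈)
    ... | x⟶u with noUnique ([ ⟶⇒≢ x⟶u , x∉⁅y⁆⇒x≢y (x∈p─q⇒x∉q (N⁻ D u) ⁅ v ⁆ x∈) ]′ ∘ cases) u∈W x⟶u
    ...   | w′ , w′∈W , w′≢u , x⟶w′ with cases w′∈W
    ...     | inj₁ refl = contradiction refl w′≢u
    ...     | inj₂ refl = x∈p∧x≢y⇒x∈p-y (∈N⁻⁺ x⟶w′) (⟶⇒≢ x⟶u)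

    to : HasFort 2 → HasTwins
    to (W , (_ , noUnique) , ∣W∣≡2) with ∣p∣≡2⇒p≡⁅u⁆∪⁅v⁆ W ∣W∣≡2
    ... | u , v , u≢v , refl = u , v , u≢v , ⊆-antisym
      (shared noUnique (p⊆p∪q _ (x∈⁅x⁆ u)) ∈⁅u⁆∪⁅v⁆⁻)
      (shared noUnique (q⊆p∪q _ _ (x∈⁅x⁆ v)) (Sum.swap ∘ ∈⁅u⁆∪⁅v⁆⁻))

    from : HasTwins → HasFort 2
    from (u , v , u≢v , eq) =
      ⁅ u ⁆ ∪ ⁅ v ⁆ , ((u , u∈) , noUnique) , ∣⁅u⁆∪⁅v⁆∣≡2 u≢v
      where
      u∈ : u ∈ ⁅ u ⁆ ∪ ⁅ v ⁆
      u∈ = p⊆p∪q _ (x∈⁅x⁆ u)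

      v∈ : v ∈ ⁅ u ⁆ ∪ ⁅ v ⁆
      v∈ = q⊆p∪q _ _ (x∈⁅x⁆ v)

      transfer : ∀ {x u v} → N⁻ D u - v ≡ N⁻ D v - u → x ≢ v → x ⟶ u → x ⟶ v
      transfer {x} {u} {v} eq x≢v x⟶u =
        ∈N⁻⁻ (p─q⊆p (N⁻ D v) ⁅ u ⁆ (subst (x ∈_) eq (x∈p∧x≢y⇒x∈p-y (∈N⁻⁺ x⟶u) x≢v)))

      noUnique : NoUniqueOutNeighbour (⁅ u ⁆ ∪ ⁅ v ⁆)
      noUnique x∉ w∈ x⟶w with ∈⁅u⁆∪⁅v⁆⁻ w∈
      ... | inj₁ refl = v , v∈ , ≢-sym u≢v , transfer eq (λ { refl → x∉ v∈ }) x⟶w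
      ... | inj₂ refl = u , u∈ , u≢v , transfer (sym eq) (λ { refl → x∉ u∈ }) x⟶w

  -- This is the fort condition of the triple for arcs ending at `u`: the second out-neighbour is
  -- `v` or `w`.
  Covered : Fin n → Fin n → Fin n → Set
  Covered u v w = N⁻ D u ─ (⁅ v ⁆ ∪ ⁅ w ⁆) ⊆ N⁻ D v ∪ N⁻ D w

  HasCoveredTriple : Set
  HasCoveredTriple = ∃ λ u → ∃ λ v → ∃ λ w →
    u ≢ v × u ≢ w × v ≢ w × Covered u v w × Covered v u w × Covered w u v

  HasFort3⇔ : HasFort 3 ⇔ HasCoveredTriple
  HasFort3⇔ = mk⇔ to from
    where
    -- As with `shared`, an abstract `W` lets one argument serve all three choices of the
    -- distinguished vertex, with only the case split permuted.
    covered : ∀ {W u v w} → NoUniqueOutNeighbour W → u ∈ W →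
              (∀ {x} → x ∈ W → x ≡ u ⊎ x ≡ v ⊎ x ≡ w) → Covered u v w
    covered {W} {u} {v} {w} noUnique u∈W cases {x} x∈ = ∈union (noUnique x∉W u∈W x⟶u)
      where
      x⟶u : x ⟶ u
      x⟶u = ∈N⁻⁻ (p─q⊆p (N⁻ D u) (⁅ v ⁆ ∪ ⁅ w ⁆) x∈)

      x∉vw : x ∉ ⁅ v ⁆ ∪ ⁅ w ⁆
      x∉vw = x∈p─q⇒x∉q (N⁻ D u) (⁅ v ⁆ ∪ ⁅ w ⁆) x∈

      x∉W : x ∉ W
      -- Looplessness excludes `u`; the set difference excludes `v` and `w`.
      x∉W x∈W with cases x∈W
      ... | inj₁ x≡u         = ⟶⇒≢ x⟶u x≡u
      ... | inj₂ (inj₁ refl) = x∉vw (p⊆p∪q _ (x∈⁅x⁆ x))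
      ... | inj₂ (inj₂ refl) = x∉vw (q⊆p∪q _ _ (x∈⁅x⁆ x))

      ∈union : (∃ λ w′ → w′ ∈ W × w′ ≢ u × x ⟶ w′) → x ∈ N⁻ D v ∪ N⁻ D w
      ∈union (w′ , w′∈W , w′≢u , x⟶w′) with cases w′∈W
      ... | inj₁ w′≡u        = contradiction w′≡u w′≢u
      ... | inj₂ (inj₁ refl) = p⊆p∪q _ (∈N⁻⁺ x⟶w′)
      ... | inj₂ (inj₂ refl) = q⊆p∪q _ _ (∈N⁻⁺ x⟶w′)

    to : HasFort 3 → HasCoveredTriple
    to (W , (_ , noUnique) , ∣W∣≡3) with ∣p∣≡3⇒p≡⁅u⁆∪⁅v⁆∪⁅w⁆ W ∣W∣≡3
    ... | u , v , w , u≢v , u≢w , v≢w , refl =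
      u , v , w , u≢v , u≢w , v≢w ,
      covered noUnique (p⊆p∪q _ (x∈⁅x⁆ u)) ∈⁅u⁆∪⁅v⁆∪⁅w⁆⁻ ,
      covered noUnique (q⊆p∪q _ _ (p⊆p∪q _ (x∈⁅x⁆ v))) (swapˡ ∘ ∈⁅u⁆∪⁅v⁆∪⁅w⁆⁻) ,
      covered noUnique (q⊆p∪q _ _ (q⊆p∪q _ _ (x∈⁅x⁆ w))) (Sum.swap ∘ Sum.assocˡ ∘ ∈⁅u⁆∪⁅v⁆∪⁅w⁆⁻)
      where
      swapˡ : {P Q R : Set} → P ⊎ Q ⊎ R → Q ⊎ P ⊎ R
      swapˡ = Sum.assocʳ ∘ Sum.map₁ Sum.swap ∘ Sum.assocˡ

    from : HasCoveredTriple → HasFort 3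
    from (u , v , w , u≢v , u≢w , v≢w , cov-u , cov-v , cov-w) =
      W , ((u , u∈) , noUnique) , ∣⁅u⁆∪⁅v⁆∪⁅w⁆∣≡3 u≢v u≢w v≢w
      where
      W : Subset n
      W = ⁅ u ⁆ ∪ (⁅ v ⁆ ∪ ⁅ w ⁆)

      u∈ : u ∈ W
      u∈ = p⊆p∪q _ (x∈⁅x⁆ u)

      v∈ : v ∈ W
      v∈ = q⊆p∪q _ _ (p⊆p∪q _ (x∈⁅x⁆ v))

      w∈ : w ∈ W
      w∈ = q⊆p∪q _ _ (q⊆p∪q _ _ (x∈⁅x⁆ w))

      other : ∀ {x a b c} → Covered a b c → x ∉ W → b ∈ W → c ∈ W → a ≢ b → a ≢ c → x ⟶ a →
              ∃ λ w′ → w′ ∈ W × w′ ≢ a × x ⟶ w′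
      other {x} {a} {b} {c} cov x∉ b∈ c∈ a≢b a≢c x⟶a
        with x∈p∪q⁻ (N⁻ D b) (N⁻ D c)
               (cov (x∈p∧x∉q⇒x∈p─q (∈N⁻⁺ x⟶a)
                 (∉⁅u⁆∪⁅v⁆ (λ { refl → x∉ b∈ }) (λ { refl → x∉ c∈ }))))
      ... | inj₁ x∈Nb = b , b∈ , ≢-sym a≢b , ∈N⁻⁻ x∈Nb
      ... | inj₂ x∈Nc = c , c∈ , ≢-sym a≢c , ∈N⁻⁻ x∈Nc

      noUnique : NoUniqueOutNeighbour W
      noUnique x∉ y∈ x⟶y with ∈⁅u⁆∪⁅v⁆∪⁅w⁆⁻ y∈
      ... | inj₁ refl        = other cov-u x∉ v∈ w∈ u≢v u≢w x⟶y
      ... | inj₂ (inj₁ refl) = other cov-v x∉ u∈ w∈ (≢-sym u≢v) v≢w x⟶y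
      ... | inj₂ (inj₂ refl) = other cov-w x∉ u∈ v∈ (≢-sym u≢w) (≢-sym v≢w) x⟶y

  ¬HasFort1⇔ : (¬ HasFort 1) ⇔ (∀ w → deg⁻ D w > 0)
  ¬HasFort1⇔ = mk⇔
    (λ none w → ℕ.n≢0⇒n>0 λ source → none (Equivalence.from HasFort1⇔ (w , source)))
    (λ pos h → let w , source = Equivalence.to HasFort1⇔ h in ℕ.n>0⇒n≢0 (pos w) source)

corollary2p3 : (n : ℕ) .{{_ : NonZero n}} (D : Digraph n) →
  (F D + 1 ≡ n ⇔ ∃ (IsSource D))
  ×
  (F D + 2 ≡ n ⇔
    ((∃₂ λ u v → u ≢ v × N⁻ D u - v ≡ N⁻ D v - u)
     × (∀ w → deg⁻ D w > 0)))
  ×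
  (F D + 3 ≡ n ⇔
    ((∀ v → deg⁻ D v > 0)
     × (∀ u v → u ≢ v → N⁻ D u - v ≢ N⁻ D v - u)
     × (∃ λ u → ∃ λ v → ∃ λ w →
          u ≢ v × u ≢ w × v ≢ w
          × N⁻ D u ─ (⁅ v ⁆ ∪ ⁅ w ⁆) ⊆ N⁻ D v ∪ N⁻ D w
          × N⁻ D v ─ (⁅ u ⁆ ∪ ⁅ w ⁆) ⊆ N⁻ D u ∪ N⁻ D w
          × N⁻ D w ─ (⁅ u ⁆ ∪ ⁅ v ⁆) ⊆ N⁻ D u ∪ N⁻ D v)))
corollary2p3 n D = part₁ , part₂ , part₃
  where
  open Equivalence

  part₁ : F D + 1 ≡ n ⇔ ∃ (IsSource D)
  part₁ = mk⇔
    (to (HasFort1⇔ D) ∘ proj₁ ∘ to (F+k≡n⇔minFort D))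
    (λ source → from (F+k≡n⇔minFort D)
      (from (HasFort1⇔ D) source , λ { z<s → ¬HasFort0 D }))

  -- Minimality of 2 concerns sizes 0 and 1: size 0 is never a fort, and size 1 is excluded exactly
  -- by positive in-degrees.
  part₂ : F D + 2 ≡ n ⇔ (HasTwins D × (∀ w → deg⁻ D w > 0))
  part₂ = mk⇔
    (λ eq → let fort , none = to (F+k≡n⇔minFort D) eq in
      to (HasFort2⇔ D) fort , to (¬HasFort1⇔ D) (none (s<s z<s)))
    (λ (twins , pos) → from (F+k≡n⇔minFort D)
      (from (HasFort2⇔ D) twins , λ where
        z<s       → ¬HasFort0 D
        (s<s z<s) → from (¬HasFort1⇔ D) pos))

  part₃ : F D + 3 ≡ n ⇔
    ((∀ v → deg⁻ D v > 0) × (∀ u v → u ≢ v → N⁻ D u - v ≢ N⁻ D v - u) × HasCoveredTriple D)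
  part₃ = mk⇔
    (λ eq → let fort , none = to (F+k≡n⇔minFort D) eq in
      to (¬HasFort1⇔ D) (none (s<s z<s)) ,
      (λ u v u≢v twins → none (s<s (s<s z<s)) (from (HasFort2⇔ D) (u , v , u≢v , twins))) ,
      to (HasFort3⇔ D) fort)
    (λ (pos , noTwins , triple) → from (F+k≡n⇔minFort D)
      (from (HasFort3⇔ D) triple , λ where
        z<s             → ¬HasFort0 D
        (s<s z<s)       → from (¬HasFort1⇔ D) pos
        -- Size 2 is the one further case compared with the previous part, and the absence of twins
        -- excludes it.
        (s<s (s<s z<s)) → λ fort → let u , v , u≢v , twins = to (HasFort2⇔ D) fort in
          noTwins u v u≢v twins))
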